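{- Let $n \geq 7$ be odd. Then the circulant graph $C(n,\{1,3\})$ is nearly dispersable.
   Context: All graphs are finite and simple. For a set $S=\{i_1<\cdots<i_k\}$ of integers with $k\ge 1$, $1\le i_1$ and $i_k\le \lfloor n/2\rfloor$, the circulant $C(n,S)$ is the graph on vertex set $\{1,\ldots,n\}$ in which each $j$ is adjacent to $j+i_r$ (addition mod $n$) for $r=1,\ldots,k$. Given a graph $G$ and a cyclic order $\omega$ on $V(G)$, draw the vertices on a circle in the order $\omega$ and the edges as straight chords; two edges cross if they intersect at a point that is not an endpoint. A matching book embedding $(G,\omega,c)$ consists of $G$, a cyclic order $\omega$, and an edge-coloring $c$ (the color classes are the pages) such that any two distinct edges of the same color neither cross nor share an endpoint. The embedding is dispersable if the number of colors equals the maximum degree $\Delta(G)$, and nearly dispersable if the number of colors equals $1+\Delta(G)$. A graph is dispersable if it has a dispersable matching book embedding; it is nearly dispersable if it is not dispersable and has a nearly dispersable matching book embedding. -}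

module Defs where

open import Data.Fin using (Fin; toℕ; _<_; _≟_)
open import Data.Fin.Permutation using (Permutation′; _⟨$⟩ʳ_)
open import Data.Fin.Properties using (nonZeroIndex; toℕ-fromℕ<)
open import Data.List using (List; []; _∷_; length; filter; map; allFin)
open import Data.List.Extrema.Nat using (max)
open import Data.List.Relation.Unary.All as All using (All; []; _∷_)
open import Data.List.Relation.Unary.Any as Any using (Any; any?)
open import Data.List.Relation.Unary.Linked using (Linked; [-]; _∷_)
import Data.Nat as ℕ
open import Data.Nat using (ℕ; suc; _+_; _*_; _≤_; z≤n; s≤s; ⌊_/2⌋)
open import Data.Nat.DivMod using (_%_; _/_; _mod_; m≡m%n+[m/n]*n)
open import Data.Nat.Divisibility using (divides; >⇒∤)
import Data.Nat.Properties as ℕ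
open import Data.Product using (_×_; _,_; ∃)
open import Data.Sum using (_⊎_; swap; [_,_])
open import Function.Definitions using (StrictlySurjective)
open import Relation.Binary using (Rel; Decidable; Symmetric; Irreflexive)
open import Relation.Binary.PropositionalEquality
  using (_≡_; _≢_; refl; sym; trans; cong; module ≡-Reasoning)
open import Relation.Nullary using (¬_)
open import Relation.Nullary.Decidable using (_⊎-dec_)
open import Level using (0ℓ)

record Graph (n : ℕ) : Set₁ where
  field
    _~_      : Rel (Fin n) 0ℓ
    _~?_     : Decidable _~_
    ~-sym    : Symmetric _~_
    ~-irrefl : Irreflexive _≡_ _~_

module _ {n : ℕ} (G : Graph n) where
  open Graph G

  degree : Fin n → ℕ
  degree v = length (filter (v ~?_) (allFin n))

  Δ : ℕ
  Δ = max 0 (map degree (allFin n))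

  -- An undirected edge is stored once, with its smaller endpoint first; the
  -- proofs are irrelevant, so edges are equal exactly when their endpoints are.
  record Edge : Set where
    constructor edge
    field
      src tgt  : Fin n
      .src<tgt : src < tgt
      .adj     : src ~ tgt

module _ {n : ℕ} {G : Graph n} where

  _∈ₑ_ : Fin n → Edge G → Set
  v ∈ₑ e = v ≡ Edge.src e ⊎ v ≡ Edge.tgt e

  ShareEndpoint : Edge G → Edge G → Set
  ShareEndpoint e f = ∃ λ v → v ∈ₑ e × v ∈ₑ f

-- Travelling round the circle from p in increasing direction, one meets q
-- strictly before r.
Cyclic : ∀ {n} → Fin n → Fin n → Fin n → Set
Cyclic p q r = (p < q × q < r) ⊎ (q < r × r < p) ⊎ (r < p × p < q)

-- The chords pq and rs of a circle meet in a point interior to both: r and s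
-- lie in different open arcs of the circle minus p and q.
ChordsCross : ∀ {n} → (p q r s : Fin n) → Set
ChordsCross p q r s = (Cyclic p r q × Cyclic q s p) ⊎ (Cyclic p s q × Cyclic q r p)

-- A cyclic order on the vertices is given by a bijection ω from vertices to
-- positions 0, …, n-1 around the circle; ω up to rotation is the cyclic order,
-- and crossing is invariant under rotation.
Cross : ∀ {n} {G : Graph n} → Permutation′ n → Edge G → Edge G → Set
Cross ω e f = ChordsCross (ω ⟨$⟩ʳ src e) (ω ⟨$⟩ʳ tgt e) (ω ⟨$⟩ʳ src f) (ω ⟨$⟩ʳ tgt f)
  where open Edge

-- Surjectivity of the colouring makes k the number of colours actually used.
record MatchingBookEmbedding {n : ℕ} (G : Graph n) (k : ℕ) : Set where
  field
    ω           : Permutation′ n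
    colour      : Edge G → Fin k
    colour-surj : StrictlySurjective _≡_ colour
    noncrossing : ∀ e f → e ≢ f → colour e ≡ colour f → ¬ Cross ω e f
    matching    : ∀ e f → e ≢ f → colour e ≡ colour f → ¬ ShareEndpoint e f

Dispersable : ∀ {n} → Graph n → Set
Dispersable G = MatchingBookEmbedding G (Δ G)

NearlyDispersable : ∀ {n} → Graph n → Set
NearlyDispersable G = ¬ Dispersable G × MatchingBookEmbedding G (1 + Δ G)

record JumpSet (n : ℕ) : Set where
  field
    jumps      : List ℕ
    nonempty   : 1 ≤ length jumps
    increasing : Linked ℕ._<_ jumps
    bounded    : All (λ s → 1 ≤ s × s ≤ ⌊ n /2⌋) jumps

-- Addition modulo n; the vertices 1, …, n are represented by their residues,
-- so that n becomes 0.
_⊕_ : ∀ {n} → Fin n → ℕ → Fin n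
_⊕_ {n} j s = _mod_ (toℕ j + s) n {{nonZeroIndex j}}

⊕-noFix : ∀ {n s} (j : Fin n) → 1 ≤ s → s ≤ ⌊ n /2⌋ → j ⊕ s ≢ j
⊕-noFix {n@(suc m)} {s@(suc _)} j _ s≤n/2 eq =
  >⇒∤ (ℕ.≤-<-trans s≤n/2 (ℕ.⌊n/2⌋<n m)) (divides q s≡q*n)
  where
  q = (toℕ j + s) / n
  s≡q*n : s ≡ q * n
  s≡q*n = ℕ.+-cancelˡ-≡ (toℕ j) s (q * n) (begin
    toℕ j + s                 ≡⟨ m≡m%n+[m/n]*n (toℕ j + s) n ⟩
    (toℕ j + s) % n + q * n   ≡⟨ cong (_+ q * n) (trans (sym (toℕ-fromℕ< _)) (cong toℕ eq)) ⟩
    toℕ j + q * n             ∎)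
    where open ≡-Reasoning

circulant : (n : ℕ) → JumpSet n → Graph n
circulant n S = record
  { _~_      = λ u v → Any (λ s → u ⊕ s ≡ v ⊎ v ⊕ s ≡ u) jumps
  ; _~?_     = λ u v → any? (λ s → (u ⊕ s ≟ v) ⊎-dec (v ⊕ s ≟ u)) jumps
  ; ~-sym    = Any.map swap
  ; ~-irrefl = λ { {u} refl u~u →
      All.lookupWith
        (λ { (1≤s , s≤n/2) → [ ⊕-noFix u 1≤s s≤n/2 , ⊕-noFix u 1≤s s≤n/2 ] })
        bounded u~u }
  }
  where open JumpSet S

⟨1,3⟩ : ∀ {n} → 7 ≤ n → JumpSet n
⟨1,3⟩ 7≤n = record
  { jumps      = 1 ∷ 3 ∷ []
  ; nonempty   = s≤s z≤n
  ; increasing = s≤s (s≤s z≤n) ∷ [-]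
  ; bounded    = (s≤s z≤n , ℕ.≤-trans (s≤s z≤n) 3≤n/2) ∷ (s≤s z≤n , 3≤n/2) ∷ []
  }
  where 3≤n/2 = ℕ.⌊n/2⌋-mono 7≤n

{-# OPTIONS --safe #-}
module Submission where

-- C(n,{1,3}) is 4-regular, so in a 4-page matching embedding every page would be
-- a perfect matching, impossible for odd n. For five pages use the natural order
-- and cut the cycle into blocks of length 4 or 5, which is possible for every odd
-- n ≥ 7 except 7 and 11; colour each vertex by its position in its block and give
-- the nested chords {i,i+3} and {i+1,i+2} the colour of i. Vertices of equal
-- colour are at cyclic distance at least 4, so the arcs [i,i+3] of one page are
-- disjoint. For n = 7 and n = 11 explicit embeddings are verified by computation.

open import Defs
open import Algebra.Properties.CommutativeSemigroup using (x∙yz≈y∙xz)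
open import Data.Bool using (if_then_else_)
open import Data.Fin as Fin using (Fin; toℕ; fromℕ<; punchOut; _≟_)
open import Data.Fin.Patterns
open import Data.Fin.Permutation as Perm using (Permutation′; _⟨$⟩ʳ_; transpose)
open import Data.Fin.Properties
  using ( toℕ<n; toℕ-injective; toℕ-fromℕ<; nonZeroIndex; all?; any?
        ; injective⇒≤; punchOut-injective)
  renaming (<-cmp to <-cmpᶠ; <-asym to <-asymᶠ; _<?_ to _<?ᶠ_)
open import Data.List using (List; []; _∷_; _++_; map; filter; length; allFin; tabulate)
open import Data.List.Extrema.Nat using (max≈v⁺)
open import Data.List.Membership.Propositional using (_∈_)
open import Data.List.Membership.Propositional.Properties
  using ( ∈-filter⁺; ∈-filter⁻; ∈-allFin; ∈-map⁺; ∈-map⁻; ∈-++⁺ˡ; ∈-++⁺ʳ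
        ; ∈-tabulate⁺; ∈-tabulate⁻)
open import Data.List.Membership.Propositional.Properties.WithK using (unique∧set⇒bag)
open import Data.List.Properties using (length-++; length-map; length-tabulate)
open import Data.List.Relation.Binary.BagAndSetEquality using (∼bag⇒↭)
open import Data.List.Relation.Binary.Permutation.Propositional.Properties using (↭-length)
open import Data.List.Relation.Unary.All using (All; []; _∷_; universal)
open import Data.List.Relation.Unary.All.Properties using () renaming (map⁺ to All-map⁺)
open import Data.List.Relation.Unary.Any using (here; there)
open import Data.List.Relation.Unary.Unique.Propositional using (Unique)
import Data.List.Relation.Unary.Unique.Propositional.Properties as Unique
open import Data.Nat hiding (_≟_)
open import Data.Nat.DivMod using (m≤n⇒[n∸m]%m≡n%m; m<n⇒m%n≡m; m*n%n≡0)
open import Data.Nat.ListAction using (sum)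
open import Data.Nat.Properties hiding (_≟_)
open import Data.Product using (_×_; _,_; ∃; proj₁; proj₂)
open import Data.Sum as Sum using (_⊎_; inj₁; inj₂)
open import Data.Vec using (Vec; []; _∷_; lookup)
open import Function using (_∘_; mk⇔)
open import Function.Definitions using (Injective)
open import Relation.Binary using (tri<; tri≈; tri>)
open import Relation.Binary.PropositionalEquality
open import Relation.Nullary using (¬_; Dec; yes; no; does; contradiction)
open import Relation.Nullary.Decidable
  using (decidable-stable; recompute; toWitness; ¬?; _×-dec_; _⊎-dec_; _→-dec_)

-- Counting in finite sets.

unique∧sameElements⇒length≡ : ∀ {a} {A : Set a} {xs ys : List A} → Unique xs → Unique ys →
  (∀ {x} → x ∈ xs → x ∈ ys) → (∀ {x} → x ∈ ys → x ∈ xs) → length xs ≡ length ys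
unique∧sameElements⇒length≡ xs! ys! xs⊆ys ys⊆xs =
  ↭-length (∼bag⇒↭ (unique∧set⇒bag xs! ys! (mk⇔ xs⊆ys ys⊆xs)))

-- A missed value `c` could be punched out of the codomain, leaving an injection from `suc k`
-- elements into `k`.
injective⇒surjective : ∀ {k} (f : Fin k → Fin k) → Injective _≡_ _≡_ f → ∀ c → ∃ λ i → f i ≡ c
injective⇒surjective {suc k} f f-inj c with any? (λ i → f i ≟ c)
... | yes hit = hit
... | no miss = contradiction (injective⇒≤ {f = λ i → punchOut (c≢f i)}
                  (f-inj ∘ punchOut-injective (c≢f _) (c≢f _))) 1+n≰n
  where
  c≢f : ∀ i → c ≢ f i
  c≢f i c≡fi = miss (i , sym c≡fi)

-- The orbits of f pair each v < f v with its image, so {v | v < f v} and its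
-- image under f partition the domain.
fixpointFreeInvolution⇒even : ∀ {n} (f : Fin n → Fin n) → (∀ v → f (f v) ≡ v) → (∀ v → f v ≢ v) →
  n % 2 ≡ 0
fixpointFreeInvolution⇒even {n} f f² f≢ = begin
  n % 2                ≡⟨ cong (_% 2) n≡ℓ+ℓ ⟩
  (ℓ + ℓ) % 2          ≡⟨ cong (λ z → (ℓ + z) % 2) (+-identityʳ ℓ) ⟨
  (2 * ℓ) % 2          ≡⟨ cong (_% 2) (*-comm 2 ℓ) ⟩
  (ℓ * 2) % 2          ≡⟨ m*n%n≡0 ℓ 2 ⟩
  0                    ∎
  where
  open ≡-Reasoning
  up? = λ v → v <?ᶠ f v
  low = filter up? (allFin n)
  ℓ = length low
  f-inj : ∀ {x y} → f x ≡ f y → x ≡ y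
  f-inj {x} {y} eq = trans (sym (f² x)) (trans (cong f eq) (f² y))
  low! : Unique low
  low! = Unique.filter⁺ up? (Unique.allFin⁺ n)
  ∈-low⁺ : ∀ {v} → v Fin.< f v → v ∈ low
  ∈-low⁺ = ∈-filter⁺ up? (∈-allFin _)
  ∈-low⁻ : ∀ {v} → v ∈ low → v Fin.< f v
  ∈-low⁻ {v} = proj₂ ∘ ∈-filter⁻ up? {v} {allFin n}
  disjoint : ∀ {v} → ¬ (v ∈ low × v ∈ map f low)
  disjoint (v∈ , v∈f) with ∈-map⁻ f v∈f
  ... | w , w∈ , refl = <-asymᶠ (∈-low⁻ w∈) (subst (f w Fin.<_) (f² w) (∈-low⁻ v∈))
  covers : ∀ {v} → v ∈ allFin n → v ∈ low ++ map f low
  covers {v} _ with <-cmpᶠ v (f v)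
  ... | tri< v<fv _ _ = ∈-++⁺ˡ (∈-low⁺ v<fv)
  ... | tri≈ _ v≡fv _ = contradiction (sym v≡fv) (f≢ v)
  ... | tri> _ _ fv<v = ∈-++⁺ʳ low (subst (_∈ map f low) (f² v)
          (∈-map⁺ f (∈-low⁺ (subst (f v Fin.<_) (sym (f² v)) fv<v))))
  n≡ℓ+ℓ : n ≡ ℓ + ℓ
  n≡ℓ+ℓ = begin
    n                              ≡⟨ length-tabulate {n = n} (λ i → i) ⟨
    length (allFin n)              ≡⟨ unique∧sameElements⇒length≡ (Unique.allFin⁺ n)
                                        (Unique.++⁺ low! (Unique.map⁺ f-inj low!) disjoint)
                                        covers (λ _ → ∈-allFin _) ⟩
    length (low ++ map f low)      ≡⟨ length-++ low ⟩
    ℓ + length (map f low)         ≡⟨ cong (ℓ +_) (length-map f low) ⟩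
    ℓ + ℓ                          ∎

-- Edges, and colour classes in a regular graph.

module _ {n : ℕ} {G : Graph n} where
  open Graph G
  open Edge

  -- Since the smaller endpoint is stored first, only the pairing of source with source and target
  -- with target survives.
  endpoints⊆⇒≡ : (e f : Edge G) → src e ∈ₑ f → tgt e ∈ₑ f → e ≡ f
  endpoints⊆⇒≡ (edge s t s<t _) (edge _ _ _ _)   (inj₁ refl) (inj₂ refl) = refl
  endpoints⊆⇒≡ (edge s t s<t _) (edge _ _ _ _)   (inj₁ refl) (inj₁ refl) =
    contradiction (recompute (s <?ᶠ t) s<t) (<-irrefl refl)
  endpoints⊆⇒≡ (edge s t s<t _) (edge _ _ _ _)   (inj₂ refl) (inj₂ refl) =
    contradiction (recompute (s <?ᶠ t) s<t) (<-irrefl refl)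
  endpoints⊆⇒≡ (edge s t s<t _) (edge _ _ t<s _) (inj₂ refl) (inj₁ refl) =
    contradiction (recompute (t <?ᶠ s) t<s) (<-asymᶠ (recompute (s <?ᶠ t) s<t))

  joining : ∀ {u v} → u ~ v → ∃ λ (e : Edge G) → u ∈ₑ e × v ∈ₑ e
  joining {u} {v} u~v with <-cmpᶠ u v
  ... | tri< u<v _ _ = edge u v u<v u~v , inj₁ refl , inj₂ refl
  ... | tri≈ _ u≡v _ = contradiction u~v (~-irrefl u≡v)
  ... | tri> _ _ v<u = edge v u v<u (~-sym u~v) , inj₂ refl , inj₁ refl

  other-unique : ∀ {u v w} {e : Edge G} → v ≢ u → w ≢ u → u ∈ₑ e → v ∈ₑ e → w ∈ₑ e → v ≡ w
  other-unique v≢u w≢u _           (inj₁ refl) (inj₁ refl) = refl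
  other-unique v≢u w≢u _           (inj₂ refl) (inj₂ refl) = refl
  other-unique v≢u w≢u (inj₁ refl) (inj₁ refl) (inj₂ refl) = contradiction refl v≢u
  other-unique v≢u w≢u (inj₁ refl) (inj₂ refl) (inj₁ refl) = contradiction refl w≢u
  other-unique v≢u w≢u (inj₂ refl) (inj₁ refl) (inj₂ refl) = contradiction refl w≢u
  other-unique v≢u w≢u (inj₂ refl) (inj₂ refl) (inj₁ refl) = contradiction refl v≢u

-- Regularity is given as an injective enumeration of neighbours by `Fin k`: it yields the degree,
-- and makes the colours seen at a vertex a self-map of `Fin k`.
module Regular {n k : ℕ} (G : Graph n)
  (nb : Fin n → Fin k → Fin n)
  (nb-injective : ∀ v → Injective _≡_ _≡_ (nb v))
  (nb-adjacent  : ∀ v i → Graph._~_ G v (nb v i))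
  (nb-complete  : ∀ v w → Graph._~_ G v w → ∃ λ i → w ≡ nb v i)
  where

  open Graph G

  degree≡k : ∀ v → degree G v ≡ k
  degree≡k v = trans
    (unique∧sameElements⇒length≡ (Unique.filter⁺ (v ~?_) (Unique.allFin⁺ n))
      (Unique.tabulate⁺ (nb-injective v)) to from)
    (length-tabulate (nb v))
    where
    to : ∀ {w} → w ∈ filter (v ~?_) (allFin n) → w ∈ tabulate (nb v)
    to {w} w∈ with nb-complete v w (proj₂ (∈-filter⁻ (v ~?_) {w} {allFin n} w∈))
    ... | i , refl = ∈-tabulate⁺ i
    from : ∀ {w} → w ∈ tabulate (nb v) → w ∈ filter (v ~?_) (allFin n)
    from w∈ with ∈-tabulate⁻ w∈
    ... | i , refl = ∈-filter⁺ (v ~?_) (∈-allFin _) (nb-adjacent v i)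

  Δ≡k : Fin n → Δ G ≡ k
  Δ≡k v = max≈v⁺ {xs = map (degree G) (allFin n)}
    (subst (_∈ map (degree G) (allFin n)) (degree≡k v) (∈-map⁺ (degree G) (∈-allFin v)))
    (All-map⁺ (universal (≤-reflexive ∘ degree≡k) _))
    z≤n

  -- If k colours suffice, every colour occurs at every vertex, and each colour
  -- class is a perfect matching.
  k-colourable⇒even : Fin k → MatchingBookEmbedding G k → n % 2 ≡ 0
  k-colourable⇒even c M = fixpointFreeInvolution⇒even partner partner² partner≢
    where
    open MatchingBookEmbedding M

    sameColour⇒≡ : ∀ {e f v} → colour e ≡ colour f → v ∈ₑ e → v ∈ₑ f →
      ∀ {x y} → x ∈ₑ e → y ∈ₑ f → x ≢ v → y ≢ v → x ≡ y
    sameColour⇒≡ {e} {f} {v} eq v∈e v∈f {x} {y} x∈e y∈f x≢v y≢v =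
      decidable-stable (x ≟ y) λ x≢y →
        matching e f (λ { refl → x≢y (other-unique {e = e} x≢v y≢v v∈e x∈e y∈f) }) eq (v , v∈e , v∈f)

    nb≢ : ∀ v i → nb v i ≢ v
    nb≢ v i eq = ~-irrefl (sym eq) (nb-adjacent v i)

    edgeTo : ∀ v i → ∃ λ (e : Edge G) → v ∈ₑ e × nb v i ∈ₑ e
    edgeTo v i = joining (nb-adjacent v i)

    colours-injective : ∀ v → Injective _≡_ _≡_ (λ i → colour (proj₁ (edgeTo v i)))
    colours-injective v {i} {j} eq with edgeTo v i | edgeTo v j
    ... | e , v∈e , i∈e | f , v∈f , j∈f =
      nb-injective v (sameColour⇒≡ eq v∈e v∈f i∈e j∈f (nb≢ v i) (nb≢ v j))

    index : ∀ v → ∃ λ i → colour (proj₁ (edgeTo v i)) ≡ c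
    index v = injective⇒surjective _ (colours-injective v) c

    partner : Fin n → Fin n
    partner v = nb v (proj₁ (index v))

    partner≢ : ∀ v → partner v ≢ v
    partner≢ v = nb≢ v _

    -- The edges of colour `c` chosen at `v` and at its partner meet at the partner, so they
    -- coincide and their other ends agree.
    partner² : ∀ v → partner (partner v) ≡ v
    partner² v with index v | index (partner v)
    ... | i , i-c | j , j-c with edgeTo v i | edgeTo (nb v i) j
    ... | e , v∈e , w∈e | f , w∈f , x∈f =
      sameColour⇒≡ {v = nb v i} (trans j-c (sym i-c)) w∈f w∈e x∈f v∈e (nb≢ (nb v i) j) (nb≢ v i ∘ sym)

-- Arithmetic of steps around the cycle.

-- v lies s steps after u on the cycle, travelling at most once past 0.
data Offset {n : ℕ} (u : Fin n) (s : ℕ) (v : Fin n) : Set where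
  direct  : toℕ v ≡ toℕ u + s → Offset u s v
  wrapped : toℕ v + n ≡ toℕ u + s → Offset u s v

module _ {n : ℕ} {u v : Fin n} where

  ⊕⇒Offset : ∀ {s} → s ≤ n → u ⊕ s ≡ v → Offset u s v
  ⊕⇒Offset {s} s≤n refl with toℕ u + s <? n
  ... | yes u+s<n = direct (trans (toℕ-fromℕ< _) (m<n⇒m%n≡m ⦃ nonZeroIndex u ⦄ u+s<n))
  ... | no  u+s≮n = wrapped (begin
    toℕ (u ⊕ s) + n           ≡⟨ cong (_+ n) (toℕ-fromℕ< _) ⟩
    (toℕ u + s) % n + n       ≡⟨ cong (_+ n) (m≤n⇒[n∸m]%m≡n%m n≤u+s) ⟨
    (toℕ u + s ∸ n) % n + n   ≡⟨ cong (_+ n) (m<n⇒m%n≡m (m<n+o⇒m∸n<o _ n (+-mono-<-≤ (toℕ<n u) s≤n))) ⟩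
    toℕ u + s ∸ n + n         ≡⟨ m∸n+n≡m n≤u+s ⟩
    toℕ u + s                 ∎)
    where
    open ≡-Reasoning
    instance _ = nonZeroIndex u
    n≤u+s = ≮⇒≥ u+s≮n

  Offset-unique : ∀ {s} {w : Fin n} → Offset u s v → Offset u s w → v ≡ w
  Offset-unique (direct p) (direct q) = toℕ-injective (trans p (sym q))
  Offset-unique (wrapped p) (wrapped q) = toℕ-injective (+-cancelʳ-≡ n _ _ (trans p (sym q)))
  Offset-unique {w = w} (direct p) (wrapped q) =
    contradiction (toℕ<n v) (m+n≮n (toℕ w) n ∘ subst (_< n) (trans p (sym q)))
  Offset-unique (wrapped p) (direct q) =
    contradiction (toℕ<n _) (m+n≮n (toℕ v) n ∘ subst (_< n) (trans q (sym p)))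

  Offset-jump-unique : ∀ {s t} → s < n → t < n → Offset u s v → Offset u t v → s ≡ t
  Offset-jump-unique s<n t<n (direct p) (direct q) = +-cancelˡ-≡ (toℕ u) _ _ (trans (sym p) q)
  Offset-jump-unique s<n t<n (wrapped p) (wrapped q) = +-cancelˡ-≡ (toℕ u) _ _ (trans (sym p) q)
  Offset-jump-unique {s} {t} s<n t<n (direct p) (wrapped q) = contradiction t<n
    (m+n≮n s n ∘ subst (_< n) (+-cancelˡ-≡ (toℕ u) t (s + n)
      (trans (sym q) (trans (cong (_+ n) p) (+-assoc (toℕ u) s n)))))
  Offset-jump-unique {s} {t} s<n t<n (wrapped p) (direct q) = contradiction s<n
    (m+n≮n t n ∘ subst (_< n) (+-cancelˡ-≡ (toℕ u) s (t + n)
      (trans (sym p) (trans (cong (_+ n) q) (+-assoc (toℕ u) t n)))))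

  Offset-flip : ∀ {s} → s ≤ n → Offset u s v → Offset v (n ∸ s) u
  Offset-flip {s} s≤n (direct p) = wrapped (begin
    toℕ u + n               ≡⟨ cong (toℕ u +_) (m+[n∸m]≡n s≤n) ⟨
    toℕ u + (s + (n ∸ s))   ≡⟨ +-assoc (toℕ u) s _ ⟨
    toℕ u + s + (n ∸ s)     ≡⟨ cong (_+ (n ∸ s)) p ⟨
    toℕ v + (n ∸ s)         ∎)
    where open ≡-Reasoning
  Offset-flip {s} s≤n (wrapped p) = direct (+-cancelʳ-≡ s _ _ (begin
    toℕ u + s               ≡⟨ p ⟨
    toℕ v + n               ≡⟨ cong (toℕ v +_) (m∸n+n≡m s≤n) ⟨
    toℕ v + (n ∸ s + s)     ≡⟨ +-assoc (toℕ v) _ s ⟨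
    toℕ v + (n ∸ s) + s     ∎))
    where open ≡-Reasoning

Offset-∸ : ∀ {n} {u v w : Fin n} {s t} → Offset u s v → Offset u (s + t) w → Offset v t w
Offset-∸ {u = u} {s = s} {t} (direct p) (direct q) =
  direct (trans q (trans (sym (+-assoc (toℕ u) s t)) (cong (_+ t) (sym p))))
Offset-∸ {u = u} {s = s} {t} (direct p) (wrapped q) =
  wrapped (trans q (trans (sym (+-assoc (toℕ u) s t)) (cong (_+ t) (sym p))))
-- Passing 0 within the first `s` steps makes `toℕ u + (s + t)` at least `n`, too large to be
-- `toℕ w`.
Offset-∸ {n} {u} {v} {w} {s} {t} (wrapped p) (direct q) = contradiction (toℕ<n w) (≤⇒≯ (begin
    n                   ≤⟨ m≤n+m n (toℕ v) ⟩
    toℕ v + n           ≡⟨ p ⟩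
    toℕ u + s           ≤⟨ +-monoʳ-≤ (toℕ u) (m≤m+n s t) ⟩
    toℕ u + (s + t)     ≡⟨ q ⟨
    toℕ w               ∎))
    where open ≤-Reasoning
Offset-∸ {n} {u} {v} {w} {s} {t} (wrapped p) (wrapped q) = direct (+-cancelʳ-≡ n _ _ (begin
    toℕ w + n           ≡⟨ q ⟩
    toℕ u + (s + t)     ≡⟨ +-assoc (toℕ u) s t ⟨
    toℕ u + s + t       ≡⟨ cong (_+ t) p ⟨
    toℕ v + n + t       ≡⟨ +-assoc (toℕ v) n t ⟩
    toℕ v + (n + t)     ≡⟨ cong (toℕ v +_) (+-comm n t) ⟩
    toℕ v + (t + n)     ≡⟨ +-assoc (toℕ v) t n ⟨
    toℕ v + t + n       ∎))
    where open ≡-Reasoning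

Offset-unflip : ∀ {n} {u v : Fin n} {s} → s ≤ n → Offset u (n ∸ s) v → Offset v s u
Offset-unflip {n} {u} {v} {s} s≤n o =
  subst (λ t → Offset v t u) (m∸[m∸n]≡n s≤n) (Offset-flip (m∸n≤m n s) o)

⊕-Offset : ∀ {n} (u : Fin n) {s} → s ≤ n → Offset u s (u ⊕ s)
⊕-Offset u s≤n = ⊕⇒Offset s≤n refl

Offset⇒⊕ : ∀ {n} {u v : Fin n} {s} → s ≤ n → Offset u s v → u ⊕ s ≡ v
Offset⇒⊕ {u = u} s≤n = Offset-unique (⊕-Offset u s≤n)

-- Four-regularity of the circulant.

-- The backward jumps by 3 and 1 are written as forward jumps, so that all four neighbours have the
-- form `v ⊕ s`.
step : ℕ → Fin 4 → ℕ
step n 0F = 1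
step n 1F = 3
step n 2F = n ∸ 3
step n 3F = n ∸ 1

step<n : ∀ {n} → 7 ≤ n → ∀ i → step n i < n
step<n 7≤n 0F = ≤-trans (m≤m+n 2 5) 7≤n
step<n 7≤n 1F = ≤-trans (m≤m+n 4 3) 7≤n
step<n 7≤n 2F = ∸-monoʳ-< z<s (≤-trans (m≤m+n 3 4) 7≤n)
step<n 7≤n 3F = ∸-monoʳ-< z<s (≤-trans (m≤m+n 1 6) 7≤n)

step-injective : ∀ {n} → 7 ≤ n → Injective _≡_ _≡_ (step n)
-- For `n` equal to `7 + m` the jumps compute to 1, 3, `4 + m` and `6 + m`; all clashes but that of
-- the last two are refuted by constructors.
step-injective (s≤s (s≤s (s≤s (s≤s (s≤s (s≤s (s≤s (z≤n {m})))))))) = injective _ _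
  where
  injective : ∀ i j → step (7 + m) i ≡ step (7 + m) j → i ≡ j
  injective 0F 0F _ = refl
  injective 0F 1F ()
  injective 0F 2F ()
  injective 0F 3F ()
  injective 1F 0F ()
  injective 1F 1F _ = refl
  injective 1F 2F ()
  injective 1F 3F ()
  injective 2F 0F ()
  injective 2F 1F ()
  injective 2F 2F _ = refl
  injective 2F 3F eq = contradiction eq (m≢1+n+m (4 + m) {1})
  injective 3F 0F ()
  injective 3F 1F ()
  injective 3F 2F eq = contradiction (sym eq) (m≢1+n+m (4 + m) {1})
  injective 3F 3F _ = refl

module CirculantRegular {n : ℕ} (7≤n : 7 ≤ n) where
  open Graph (circulant n (⟨1,3⟩ 7≤n))

  nb : Fin n → Fin 4 → Fin n
  nb v i = v ⊕ step n i

  nb-offset : ∀ v i → Offset v (step n i) (nb v i)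
  nb-offset v i = ⊕-Offset v (<⇒≤ (step<n 7≤n i))

  nb-injective : ∀ v → Injective _≡_ _≡_ (nb v)
  nb-injective v {i} {j} eq = step-injective 7≤n
    (Offset-jump-unique (step<n 7≤n i) (step<n 7≤n j) (nb-offset v i)
      (subst (Offset v (step n j)) (sym eq) (nb-offset v j)))

  1≤n : 1 ≤ n
  1≤n = ≤-trans (m≤m+n 1 6) 7≤n
  3≤n : 3 ≤ n
  3≤n = ≤-trans (m≤m+n 3 4) 7≤n

  nb-adjacent : ∀ v i → v ~ nb v i
  nb-adjacent v 0F = here (inj₁ refl)
  nb-adjacent v 1F = there (here (inj₁ refl))
  nb-adjacent v 2F = there (here (inj₂ (Offset⇒⊕ 3≤n (Offset-unflip {u = v} 3≤n (nb-offset v 2F)))))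
  nb-adjacent v 3F = here (inj₂ (Offset⇒⊕ 1≤n (Offset-unflip {u = v} 1≤n (nb-offset v 3F))))

  nb-complete : ∀ v w → v ~ w → ∃ λ i → w ≡ nb v i
  nb-complete v w (here (inj₁ eq)) = 0F , sym eq
  nb-complete v w (here (inj₂ eq)) =
    3F , Offset-unique (Offset-flip 1≤n (⊕⇒Offset 1≤n eq)) (nb-offset v 3F)
  nb-complete v w (there (here (inj₁ eq))) = 1F , sym eq
  nb-complete v w (there (here (inj₂ eq))) =
    2F , Offset-unique (Offset-flip 3≤n (⊕⇒Offset 3≤n eq)) (nb-offset v 2F)

  open Regular (circulant n (⟨1,3⟩ 7≤n)) nb nb-injective nb-adjacent nb-complete public

-- Noncrossing chords through separating intervals.

In Out : ∀ {n} → ℕ → ℕ → Fin n → Set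
In  lo hi w = lo ≤ toℕ w × toℕ w ≤ hi
Out lo hi w = toℕ w < lo ⊎ hi < toℕ w

-- This certificate reduces both page conditions to linear inequalities. It is asymmetric: the arc
-- inside must not straddle 0, while the one outside may.
Separated : ∀ {n} → (Fin n → Set) → (Fin n → Set) → Set
Separated P Q = ∃ λ lo → ∃ λ hi → (∀ {w} → P w → In lo hi w) × (∀ {w} → Q w → Out lo hi w)

Separated-⊆ : ∀ {n} {P P′ Q Q′ : Fin n → Set} → (∀ {w} → P′ w → P w) → (∀ {w} → Q′ w → Q w) →
  Separated P Q → Separated P′ Q′
Separated-⊆ P′⊆P Q′⊆Q (lo , hi , inside , outside) = lo , hi , inside ∘ P′⊆P , outside ∘ Q′⊆Q

module _ {n lo hi : ℕ} {p q : Fin n} (p∈ : In lo hi p) (q∈ : In lo hi q) where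

  In⇒¬Out : ∀ {r : Fin n} → In lo hi r → ¬ Out lo hi r
  In⇒¬Out (lo≤r , _) (inj₁ r<lo) = <⇒≱ r<lo lo≤r
  In⇒¬Out (_ , r≤hi) (inj₂ hi<r) = <⇒≱ hi<r r≤hi

  between⇒In : ∀ {r : Fin n} → toℕ p < toℕ r → toℕ r < toℕ q → In lo hi r
  between⇒In p<r r<q = ≤-trans (proj₁ p∈) (<⇒≤ p<r) , ≤-trans (<⇒≤ r<q) (proj₂ q∈)

  -- A point strictly between `p` and `q` in linear order would lie inside the interval; the two
  -- wrapped orders already contain `q` before `p`.
  Cyclic-Out⇒> : ∀ {r} → Out lo hi r → Cyclic p r q → toℕ q < toℕ p
  Cyclic-Out⇒> r∉ (inj₁ (p<r , r<q))        = contradiction r∉ (In⇒¬Out (between⇒In p<r r<q))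
  Cyclic-Out⇒> r∉ (inj₂ (inj₁ (r<q , q<p))) = q<p
  Cyclic-Out⇒> r∉ (inj₂ (inj₂ (q<p , p<r))) = q<p

  Out-below : ∀ {r : Fin n} → Out lo hi r → toℕ r < toℕ p → toℕ r < toℕ q
  Out-below (inj₁ r<lo) _   = <-≤-trans r<lo (proj₁ q∈)
  Out-below (inj₂ hi<r) r<p = contradiction (≤-trans (<⇒≤ r<p) (proj₂ p∈)) (<⇒≱ hi<r)

  Out-above : ∀ {r : Fin n} → Out lo hi r → toℕ p < toℕ r → toℕ q < toℕ r
  Out-above (inj₁ r<lo) p<r = contradiction (≤-trans (proj₁ p∈) (<⇒≤ p<r)) (<⇒≱ r<lo)
  Out-above (inj₂ hi<r) _   = ≤-<-trans (proj₂ q∈) hi<r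

  -- Points outside the interval cannot tell its members apart, so `p` may be traded for `q`.
  Cyclic-In-shift : ∀ {r s} → Out lo hi r → Out lo hi s → Cyclic r p s → Cyclic r q s
  Cyclic-In-shift r∉ s∉ (inj₁ (r<p , p<s))        = inj₁ (Out-below r∉ r<p , Out-above s∉ p<s)
  Cyclic-In-shift r∉ s∉ (inj₂ (inj₁ (p<s , s<r))) = inj₂ (inj₁ (Out-above s∉ p<s , s<r))
  Cyclic-In-shift r∉ s∉ (inj₂ (inj₂ (s<r , r<p))) = inj₂ (inj₂ (s<r , Out-below r∉ r<p))

Cyclic-asym : ∀ {n} {p q r : Fin n} → Cyclic p q r → ¬ Cyclic r q p
Cyclic-asym (inj₁ (p<q , q<r))        (inj₁ (r<q , q<p))        = <-asym p<q q<p
Cyclic-asym (inj₁ (p<q , q<r))        (inj₂ (inj₁ (q<p , p<r))) = <-asym p<q q<p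
Cyclic-asym (inj₁ (p<q , q<r))        (inj₂ (inj₂ (p<r , r<q))) = <-asym q<r r<q
Cyclic-asym (inj₂ (inj₁ (q<r , r<p))) (inj₁ (r<q , q<p))        = <-asym q<r r<q
Cyclic-asym (inj₂ (inj₁ (q<r , r<p))) (inj₂ (inj₁ (q<p , p<r))) = <-asym r<p p<r
Cyclic-asym (inj₂ (inj₁ (q<r , r<p))) (inj₂ (inj₂ (p<r , r<q))) = <-asym r<p p<r
Cyclic-asym (inj₂ (inj₂ (r<p , p<q))) (inj₁ (r<q , q<p))        = <-asym p<q q<p
Cyclic-asym (inj₂ (inj₂ (r<p , p<q))) (inj₂ (inj₁ (q<p , p<r))) = <-asym r<p p<r
Cyclic-asym (inj₂ (inj₂ (r<p , p<q))) (inj₂ (inj₂ (p<r , r<q))) = <-asym r<p p<r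

module _ {n lo hi : ℕ} {p q r s : Fin n}
  (p∈ : In lo hi p) (q∈ : In lo hi q) (r∉ : Out lo hi r) (s∉ : Out lo hi s) where

  -- A crossing puts an outside point on each arc between `p` and `q`, forcing both `q < p` and
  -- `p < q`.
  inner-outer-noncrossing : ¬ ChordsCross p q r s
  inner-outer-noncrossing (inj₁ (prq , qsp)) =
    <-asym (Cyclic-Out⇒> p∈ q∈ r∉ prq) (Cyclic-Out⇒> q∈ p∈ s∉ qsp)
  inner-outer-noncrossing (inj₂ (psq , qrp)) =
    <-asym (Cyclic-Out⇒> p∈ q∈ s∉ psq) (Cyclic-Out⇒> q∈ p∈ r∉ qrp)

  -- Trading one end of the inner chord for the other gives opposite cyclic orders of the same three
  -- points.
  outer-inner-noncrossing : ¬ ChordsCross r s p q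
  outer-inner-noncrossing (inj₁ (rps , sqr)) = Cyclic-asym (Cyclic-In-shift p∈ q∈ r∉ s∉ rps) sqr
  outer-inner-noncrossing (inj₂ (rqs , spr)) = Cyclic-asym (Cyclic-In-shift q∈ p∈ r∉ s∉ rqs) spr

module _ {n : ℕ} {G : Graph n} (e f : Edge G) where
  open Edge

  EdgesSeparated : Set
  EdgesSeparated = Separated (_∈ₑ e) (_∈ₑ f) ⊎ Separated (_∈ₑ f) (_∈ₑ e)

  separated⇒noncrossing : EdgesSeparated → ¬ Cross Perm.id e f
  separated⇒noncrossing (inj₁ (_ , _ , inside , outside)) =
    inner-outer-noncrossing (inside (inj₁ refl)) (inside (inj₂ refl))
      (outside (inj₁ refl)) (outside (inj₂ refl))
  separated⇒noncrossing (inj₂ (_ , _ , inside , outside)) =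
    outer-inner-noncrossing (inside (inj₁ refl)) (inside (inj₂ refl))
      (outside (inj₁ refl)) (outside (inj₂ refl))

  separated⇒disjoint : EdgesSeparated → ¬ ShareEndpoint e f
  separated⇒disjoint (inj₁ (_ , _ , inside , outside)) (v , v∈e , v∈f) =
    In⇒¬Out (inside v∈e) (inside v∈e) (inside v∈e) (outside v∈f)
  separated⇒disjoint (inj₂ (_ , _ , inside , outside)) (v , v∈e , v∈f) =
    In⇒¬Out (inside v∈f) (inside v∈f) (inside v∈f) (outside v∈e)

-- Chords on arcs of four vertices.

-- The arc i, i+1, i+2, i+3 carries the two nested chords {i, i+3} and {i+1, i+2}.
data Kind : Set where
  outer inner : Kind

near far : Kind → ℕ
near outer = 0
near inner = 1
far outer = 3
far inner = 2

OnChord : ∀ {n} → Fin n → Kind → Fin n → Set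
OnChord i k w = Offset i (near k) w ⊎ Offset i (far k) w

OnArc : ∀ {n} → Fin n → Fin n → Set
OnArc i w = ∃ λ d → d ≤ 3 × Offset i d w

OnChord⇒OnArc : ∀ {n} {i : Fin n} k {w} → OnChord i k w → OnArc i w
OnChord⇒OnArc outer (inj₁ o) = 0 , z≤n , o
OnChord⇒OnArc outer (inj₂ o) = 3 , ≤-refl , o
OnChord⇒OnArc inner (inj₁ o) = 1 , s≤s z≤n , o
OnChord⇒OnArc inner (inj₂ o) = 2 , s≤s (s≤s z≤n) , o

Offset-position : ∀ {n} {i w : Fin n} {d} → Offset i d w →
  toℕ w ≡ d + toℕ i ⊎ toℕ w + n ≡ d + toℕ i
Offset-position {i = i} {d = d} (direct eq)  = inj₁ (trans eq (+-comm (toℕ i) d))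
Offset-position {i = i} {d = d} (wrapped eq) = inj₂ (trans eq (+-comm (toℕ i) d))

direct-position : ∀ {n} {i w : Fin n} {d} → d + toℕ i < n → Offset i d w → toℕ w ≡ d + toℕ i
direct-position {n} {i} {w} i+d<n o with Offset-position o
... | inj₁ eq = eq
... | inj₂ eq = contradiction (subst (_< n) (sym eq) i+d<n) (m+n≮n (toℕ w) n)

wrapped-position : ∀ {n} {i w : Fin n} {d} → n ≤ d + toℕ i → Offset i d w → toℕ w + n ≡ d + toℕ i
wrapped-position {n} {w = w} n≤i+d o with Offset-position o
... | inj₁ eq = contradiction (toℕ<n w) (≤⇒≯ (subst (n ≤_) (sym eq) n≤i+d))
... | inj₂ eq = eq

-- The arc of `i` ends before `j`, hence does not pass 0 and is an interval. The arc of `j` may pass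
-- 0, but the second bound stops it before `i`.
arcs-separated : ∀ {n} {i j : Fin n} → 4 + toℕ i ≤ toℕ j → 4 + toℕ j ≤ toℕ i + n →
  Separated (OnArc i) (OnArc j)
arcs-separated {n} {i} {j} 4+i≤j 4+j≤i+n = toℕ i , 3 + toℕ i , inside , outside
  where
  inside : ∀ {w} → OnArc i w → In (toℕ i) (3 + toℕ i) w
  inside {w} (d , d≤3 , o) = subst (toℕ i ≤_) (sym eq) (m≤n+m (toℕ i) d) ,
                             subst (_≤ 3 + toℕ i) (sym eq) (+-monoˡ-≤ (toℕ i) d≤3)
    where
    eq : toℕ w ≡ d + toℕ i
    eq = direct-position (≤-<-trans (+-monoˡ-≤ (toℕ i) d≤3) (<-trans 4+i≤j (toℕ<n j))) o
  outside : ∀ {w} → OnArc j w → Out (toℕ i) (3 + toℕ i) w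
  outside {w} (d , d≤3 , o) with Offset-position o
  ... | inj₁ eq = inj₂ (≤-trans 4+i≤j (subst (toℕ j ≤_) (sym eq) (m≤n+m (toℕ j) d)))
  ... | inj₂ eq = inj₁ (+-cancelʳ-< n _ _
          (≤-trans (s≤s (≤-trans (≤-reflexive eq) (+-monoˡ-≤ (toℕ j) d≤3))) 4+j≤i+n))

-- The span of the inner chord separates unless 0 falls between its two ends, so the interval
-- depends on where the arc meets 0.
nested-separated : ∀ {n} → 3 < n → (i : Fin n) →
  Separated (OnChord i inner) (OnChord i outer) ⊎ Separated (OnChord i outer) (OnChord i inner)
nested-separated {n} 3<n i with 2 + toℕ i <? n | 1 + toℕ i <? n
... | yes i+2<n | _ = inj₁ (1 + toℕ i , 2 + toℕ i , inside , outside)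
  where
  inside : ∀ {w} → OnChord i inner w → In (1 + toℕ i) (2 + toℕ i) w
  inside (inj₁ o) with direct-position (<⇒≤ i+2<n) o
  ... | eq = ≤-reflexive (sym eq) , ≤-trans (≤-reflexive eq) (n≤1+n _)
  inside (inj₂ o) with direct-position i+2<n o
  ... | eq = ≤-trans (n≤1+n _) (≤-reflexive (sym eq)) , ≤-reflexive eq
  outside : ∀ {w} → OnChord i outer w → Out (1 + toℕ i) (2 + toℕ i) w
  outside (inj₁ o) = inj₁ (s≤s (≤-reflexive (direct-position (toℕ<n i) o)))
  outside {w} (inj₂ o) with Offset-position o
  ... | inj₁ eq = inj₂ (≤-reflexive (sym eq))
  ... | inj₂ eq = inj₁ (+-cancelʳ-< n (toℕ w) _ (begin-strict
    toℕ w + n         ≡⟨ eq ⟩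
    3 + toℕ i         <⟨ +-monoˡ-< (toℕ i) 3<n ⟩
    n + toℕ i         ≤⟨ n≤1+n _ ⟩
    1 + (n + toℕ i)   ≡⟨ cong suc (+-comm n (toℕ i)) ⟩
    1 + toℕ i + n     ∎))
    where open ≤-Reasoning
-- Here `i` is `n - 2`: the inner chord joins `n - 1` to 0, and the interval from 1 to `n - 2` holds
-- the outer chord instead.
... | no i+2≮n | yes i+1<n = inj₂ (1 , toℕ i , inside , outside)
  where
  n≤2+i : n ≤ 2 + toℕ i
  n≤2+i = ≮⇒≥ i+2≮n
  inside : ∀ {w} → OnChord i outer w → In 1 (toℕ i) w
  inside (inj₁ o) with direct-position (toℕ<n i) o
  ... | eq = ≤-trans (s≤s⁻¹ (s≤s⁻¹ (≤-trans (<⇒≤ 3<n) n≤2+i))) (≤-reflexive (sym eq)) , ≤-reflexive eq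
  inside {w} (inj₂ o) with wrapped-position (m≤n⇒m≤1+n n≤2+i) o
  ... | eq = +-cancelʳ-≤ n _ _ (≤-trans (s≤s n≤2+i) (≤-reflexive (sym eq))) ,
             +-cancelʳ-≤ n _ _ (≤-trans (≤-reflexive eq)
               (subst (3 + toℕ i ≤_) (+-comm n (toℕ i)) (+-monoˡ-≤ (toℕ i) (<⇒≤ 3<n))))
  outside : ∀ {w} → OnChord i inner w → Out 1 (toℕ i) w
  outside (inj₁ o) = inj₂ (≤-reflexive (sym (direct-position i+1<n o)))
  outside (inj₂ o) = inj₁ (+-cancelʳ-< n _ _ (s≤s (≤-trans (≤-reflexive (wrapped-position n≤2+i o)) i+1<n)))
-- Here `i` is `n - 1`: the inner chord joins 0 to 1, the outer one `n - 1` to 2.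
... | no i+2≮n | no i+1≮n = inj₁ (0 , 1 , inside , outside)
  where
  n≤1+i : n ≤ 1 + toℕ i
  n≤1+i = ≮⇒≥ i+1≮n
  inside : ∀ {w} → OnChord i inner w → In 0 1 w
  inside (inj₁ o) = z≤n , +-cancelʳ-≤ n _ _
    (≤-trans (≤-reflexive (wrapped-position n≤1+i o)) (s≤s (<⇒≤ (toℕ<n i))))
  inside (inj₂ o) = z≤n , +-cancelʳ-≤ n _ _
    (≤-trans (≤-reflexive (wrapped-position (m≤n⇒m≤1+n n≤1+i) o)) (s≤s (toℕ<n i)))
  outside : ∀ {w} → OnChord i outer w → Out 0 1 w
  outside (inj₁ o) = inj₂ (≤-trans (s≤s⁻¹ (≤-trans (<⇒≤ 3<n) n≤1+i))
    (≤-reflexive (sym (direct-position (toℕ<n i) o))))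
  outside (inj₂ o) = inj₂ (+-cancelʳ-≤ n _ _ (≤-trans (s≤s (s≤s n≤1+i))
    (≤-reflexive (sym (wrapped-position (m≤n⇒m≤1+n (m≤n⇒m≤1+n n≤1+i)) o)))))

-- Colouring by blocks.

-- A vertex is coloured by its position in its block, when the cycle is cut into
-- consecutive blocks of the given lengths; blocks of length 4 or 5 make any four
-- cyclically consecutive vertices differ.
blockColour : List ℕ → ℕ → ℕ
blockColour []       i = i
blockColour (b ∷ bs) i with i <? b
... | yes _ = i
... | no  _ = blockColour bs (i ∸ b)

blockColour≤ : ∀ bs i → blockColour bs i ≤ i
blockColour≤ []       i = ≤-refl
blockColour≤ (b ∷ bs) i with i <? b
... | yes _ = ≤-refl
... | no  _ = ≤-trans (blockColour≤ bs (i ∸ b)) (m∸n≤m i b)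

∸-<-sum : ∀ {b s i} → ¬ i < b → i < b + s → i ∸ b < s
∸-<-sum {b} {s} {i} i≮b i<b+s = +-cancelˡ-< b _ _ (subst (_< b + s) (sym (m+[n∸m]≡n (≮⇒≥ i≮b))) i<b+s)

blockColour< : ∀ {k bs} → All (_≤ k) bs → ∀ {i} → i < sum bs → blockColour bs i < k
blockColour< {bs = b ∷ bs} (b≤k ∷ bs≤k) {i} i< with i <? b
... | yes i<b = <-≤-trans i<b b≤k
... | no  i≮b = blockColour< bs≤k (∸-<-sum i≮b i<)

-- Within one block colours are positions, hence distinct. If `i` is in the first block and `j` in a
-- later one, then `i` is the colour of `j ∸ b` in the remaining blocks, so at most `j ∸ b`, and `b`
-- adds at least `k`.
blockColour-spaced : ∀ {k bs} → All (k ≤_) bs → ∀ {i j} → i < j → j < sum bs →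
  blockColour bs i ≡ blockColour bs j → k + i ≤ j
blockColour-spaced {k} {b ∷ bs} (k≤b ∷ k≤bs) {i} {j} i<j j< eq with i <? b | j <? b
... | yes i<b | yes j<b = contradiction eq (<⇒≢ i<j)
... | no  i≮b | yes j<b = contradiction (<-trans i<j j<b) i≮b
... | yes i<b | no  j≮b = begin
  k + i              ≤⟨ +-mono-≤ k≤b (≤-trans (≤-reflexive eq) (blockColour≤ bs (j ∸ b))) ⟩
  b + (j ∸ b)        ≡⟨ m+[n∸m]≡n (≮⇒≥ j≮b) ⟩
  j                  ∎
  where open ≤-Reasoning
... | no  i≮b | no  j≮b = begin
  k + i              ≡⟨ cong (k +_) (m∸n+n≡m (≮⇒≥ i≮b)) ⟨
  k + (i ∸ b + b)    ≡⟨ +-assoc k (i ∸ b) b ⟨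
  k + (i ∸ b) + b    ≤⟨ +-monoˡ-≤ b (blockColour-spaced k≤bs (∸-monoˡ-< i<j (≮⇒≥ i≮b)) (∸-<-sum j≮b j<) eq) ⟩
  j ∸ b + b          ≡⟨ m∸n+n≡m (≮⇒≥ j≮b) ⟩
  j                  ∎
  where open ≤-Reasoning

-- `j` minus its colour is the start of its block, and that block, of length at least `k`, ends by
-- `sum bs`.
blockColour-end : ∀ {k bs} → All (k ≤_) bs → ∀ {j} → j < sum bs → k + j ≤ blockColour bs j + sum bs
blockColour-end {k} {b ∷ bs} (k≤b ∷ k≤bs) {j} j< with j <? b
... | yes j<b = subst (_≤ j + (b + sum bs)) (+-comm j k) (+-monoʳ-≤ j (m≤n⇒m≤n+o (sum bs) k≤b))
... | no  j≮b = begin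
  k + j                                ≡⟨ cong (k +_) (m+[n∸m]≡n (≮⇒≥ j≮b)) ⟨
  k + (b + (j ∸ b))                    ≡⟨ x∙yz≈y∙xz +-commutativeSemigroup k b (j ∸ b) ⟩
  b + (k + (j ∸ b))                    ≤⟨ +-monoʳ-≤ b (blockColour-end k≤bs (∸-<-sum j≮b j<)) ⟩
  b + (c + sum bs)                     ≡⟨ x∙yz≈y∙xz +-commutativeSemigroup b c (sum bs) ⟩
  c + (b + sum bs)                     ∎
  where
  open ≤-Reasoning
  c = blockColour bs (j ∸ b)

-- This is the spacing across 0: the common colour is at most `i`, so the bound on the distance to
-- the end carries over.
blockColour-wraps : ∀ {k bs} → All (k ≤_) bs → ∀ {i j} → j < sum bs →
  blockColour bs i ≡ blockColour bs j → k + j ≤ i + sum bs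
blockColour-wraps {bs = bs} k≤bs {i} j< eq = ≤-trans (blockColour-end k≤bs j<)
  (+-monoˡ-≤ (sum bs) (≤-trans (≤-reflexive (sym eq)) (blockColour≤ bs i)))

-- Five pages from blocks.

-- Edges are stored by numerical order of their endpoints, chords by cyclic order along the arc; the
-- two can disagree when an arc passes 0, hence two orientations.
data Placement {n : ℕ} (u v : Fin n) : Set where
  forward  : ∀ i k → Offset i (near k) u → Offset i (far k) v → Placement u v
  backward : ∀ i k → Offset i (far k) u → Offset i (near k) v → Placement u v

module _ {n : ℕ} {u v : Fin n} where

  start : Placement u v → Fin n
  start (forward  i _ _ _) = i
  start (backward i _ _ _) = i

  kind : Placement u v → Kind
  kind (forward  _ k _ _) = k
  kind (backward _ k _ _) = k

  endpoint⇒OnChord : (p : Placement u v) → ∀ {w} → w ≡ u ⊎ w ≡ v → OnChord (start p) (kind p) w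
  endpoint⇒OnChord (forward  _ _ p q) (inj₁ refl) = inj₁ p
  endpoint⇒OnChord (forward  _ _ p q) (inj₂ refl) = inj₂ q
  endpoint⇒OnChord (backward _ _ p q) (inj₁ refl) = inj₂ p
  endpoint⇒OnChord (backward _ _ p q) (inj₂ refl) = inj₁ q

  OnChord⇒endpoint : (p : Placement u v) → ∀ {w} → OnChord (start p) (kind p) w → w ≡ u ⊎ w ≡ v
  OnChord⇒endpoint (forward  _ _ p q) (inj₁ o) = inj₁ (Offset-unique o p)
  OnChord⇒endpoint (forward  _ _ p q) (inj₂ o) = inj₂ (Offset-unique o q)
  OnChord⇒endpoint (backward _ _ p q) (inj₁ o) = inj₂ (Offset-unique o q)
  OnChord⇒endpoint (backward _ _ p q) (inj₂ o) = inj₁ (Offset-unique o p)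

swap-placement : ∀ {n} {u v : Fin n} → Placement u v → Placement v u
swap-placement (forward  i k p q) = backward i k q p
swap-placement (backward i k p q) = forward i k q p

module _ {n : ℕ} (7≤n : 7 ≤ n) where
  private
    G = circulant n (⟨1,3⟩ 7≤n)
    1≤n : 1 ≤ n
    1≤n = ≤-trans (s≤s z≤n) 7≤n
    2≤n : 2 ≤ n
    2≤n = ≤-trans (s≤s (s≤s z≤n)) 7≤n
    3<n : 3 < n
    3<n = ≤-trans (s≤s (s≤s (s≤s (s≤s z≤n)))) 7≤n
  open Graph G
  open Edge

  jump3-placement : ∀ {u v : Fin n} → u ⊕ 3 ≡ v → Placement u v
  jump3-placement {u} eq = forward u outer (direct (sym (+-identityʳ _))) (⊕⇒Offset (<⇒≤ 3<n) eq)

  jump1-placement : ∀ {u v : Fin n} → u ⊕ 1 ≡ v → Placement u v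
  jump1-placement {u} {v} eq = forward i inner i→u
    (subst (Offset i 2) (Offset-unique (Offset-∸ i→u (⊕-Offset i 2≤n)) (⊕⇒Offset 1≤n eq))
      (⊕-Offset i 2≤n))
    where
    -- An edge of consecutive vertices is the inner chord of the arc starting one vertex earlier;
    -- one step back is `n ∸ 1` steps forward.
    i = u ⊕ (n ∸ 1)
    i→u : Offset i 1 u
    i→u = Offset-unflip 1≤n (⊕-Offset u (m∸n≤m n 1))

  -- Adjacency is irrelevant here and cannot be inspected, so the four equations are decided in
  -- turn. Jump 3 comes first, which lets `place-jump3` finish after one case split.
  place : ∀ u v → .(u ~ v) → Placement u v
  place u v u~v with u ⊕ 3 ≟ v
  ... | yes eq = jump3-placement eq
  ... | no ¬u3 with v ⊕ 3 ≟ u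
  ...   | yes eq = swap-placement (jump3-placement eq)
  ...   | no ¬v3 with u ⊕ 1 ≟ v
  ...     | yes eq = jump1-placement eq
  ...     | no ¬u1 with v ⊕ 1 ≟ u
  ...       | yes eq = swap-placement (jump1-placement eq)
  ...       | no ¬v1 = contradiction (recompute (u ~? v) u~v)
    λ { (here (inj₁ eq)) → ¬u1 eq ; (here (inj₂ eq)) → ¬v1 eq
      ; (there (here (inj₁ eq))) → ¬u3 eq ; (there (here (inj₂ eq))) → ¬v3 eq }

  place-jump3 : ∀ {u v} .(u~v : u ~ v) → u ⊕ 3 ≡ v → start (place u v u~v) ≡ u
  place-jump3 {u} {v} u~v eq with u ⊕ 3 ≟ v
  ... | yes _ = refl
  ... | no ne = contradiction eq ne

  placement : (e : Edge G) → Placement (src e) (tgt e)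
  placement (edge u v _ u~v) = place u v u~v

  base : Edge G → Fin n
  base e = start {u = src e} {tgt e} (placement e)

  shape : Edge G → Kind
  shape e = kind {u = src e} {tgt e} (placement e)

  ∈ₑ⇒OnChord : ∀ e {w} → w ∈ₑ e → OnChord (base e) (shape e) w
  ∈ₑ⇒OnChord e = endpoint⇒OnChord {u = src e} {tgt e} (placement e)

  OnChord⇒∈ₑ : ∀ e {w} → OnChord (base e) (shape e) w → w ∈ₑ e
  OnChord⇒∈ₑ e = OnChord⇒endpoint {u = src e} {tgt e} (placement e)

  far-bases-separated : ∀ e f → 4 + toℕ (base e) ≤ toℕ (base f) →
    4 + toℕ (base f) ≤ toℕ (base e) + n →
    Separated (_∈ₑ e) (_∈ₑ f)
  far-bases-separated e f p q = Separated-⊆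
    (OnChord⇒OnArc (shape e) ∘ ∈ₑ⇒OnChord e)
    (OnChord⇒OnArc (shape f) ∘ ∈ₑ⇒OnChord f)
    (arcs-separated p q)

  -- Two chords of one kind on the same arc have the same endpoints, against `e ≢ f`; chords of
  -- different kinds are nested.
  chords-separated : (e f : Edge G) → e ≢ f → ∀ {i} k l →
    (∀ {w} → w ∈ₑ e → OnChord i k w) → (∀ {w} → w ∈ₑ f → OnChord i l w) →
    (∀ {w} → OnChord i l w → w ∈ₑ f) → EdgesSeparated e f
  chords-separated e f e≢f outer outer e→ f→ f← =
    contradiction (endpoints⊆⇒≡ e f (f← (e→ (inj₁ refl))) (f← (e→ (inj₂ refl)))) e≢f
  chords-separated e f e≢f inner inner e→ f→ f← =
    contradiction (endpoints⊆⇒≡ e f (f← (e→ (inj₁ refl))) (f← (e→ (inj₂ refl)))) e≢f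
  chords-separated e f e≢f {i} inner outer e→ f→ f← =
    Sum.map (Separated-⊆ e→ f→) (Separated-⊆ f→ e→) (nested-separated 3<n i)
  chords-separated e f e≢f {i} outer inner e→ f→ f← =
    Sum.swap (Sum.map (Separated-⊆ f→ e→) (Separated-⊆ e→ f→) (nested-separated 3<n i))

  same-base-separated : ∀ e f → e ≢ f → base e ≡ base f → EdgesSeparated e f
  same-base-separated e f e≢f eq = chords-separated e f e≢f (shape e) (shape f)
    (λ {w} w∈e → subst (λ i → OnChord i (shape e) w) eq (∈ₑ⇒OnChord e w∈e))
    (∈ₑ⇒OnChord f)
    (OnChord⇒∈ₑ f)

  -- The first block has length 5 so that the base vertices 0 to 4 show all five colours; `8 ≤ n`
  -- keeps the jumps by 3 from them below `n`.
  blockEmbedding : ∀ bs → All (4 ≤_) bs → All (_≤ 5) bs → 8 ≤ n → 5 + sum bs ≡ n →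
    MatchingBookEmbedding G 5
  blockEmbedding bs′ 4≤bs′ bs′≤5 8≤n sum≡n = record
    { ω           = Perm.id
    ; colour      = colour
    ; colour-surj = surj
    ; noncrossing = λ e f e≢f eq → separated⇒noncrossing e f (separated e f e≢f eq)
    ; matching    = λ e f e≢f eq → separated⇒disjoint e f (separated e f e≢f eq)
    }
    where
    bs = 5 ∷ bs′
    4≤bs : All (4 ≤_) bs
    4≤bs = n≤1+n 4 ∷ 4≤bs′

    in-range : (i : Fin n) → toℕ i < sum bs
    in-range i = subst (toℕ i <_) (sym sum≡n) (toℕ<n i)

    vertexColour : Fin n → Fin 5
    vertexColour i = fromℕ< (blockColour< (≤-refl ∷ bs′≤5) (in-range i))

    colour : Edge G → Fin 5
    colour = vertexColour ∘ base

    vertexColour≡⇒blockColour≡ : ∀ {i j} → vertexColour i ≡ vertexColour j →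
      blockColour bs (toℕ i) ≡ blockColour bs (toℕ j)
    vertexColour≡⇒blockColour≡ eq = trans (sym (toℕ-fromℕ< _)) (trans (cong toℕ eq) (toℕ-fromℕ< _))

    spaced : ∀ {i j} → i Fin.< j → vertexColour i ≡ vertexColour j →
      4 + toℕ i ≤ toℕ j × 4 + toℕ j ≤ toℕ i + n
    spaced {i} {j} i<j eq =
      blockColour-spaced 4≤bs i<j (in-range j) eq′ ,
      subst (λ z → 4 + toℕ j ≤ toℕ i + z) sum≡n (blockColour-wraps 4≤bs {i = toℕ i} (in-range j) eq′)
      where eq′ = vertexColour≡⇒blockColour≡ {i} {j} eq

    separated : ∀ e f → e ≢ f → colour e ≡ colour f → EdgesSeparated e f
    separated e f e≢f eq with <-cmpᶠ (base e) (base f)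
    ... | tri< lt _ _ = let p , q = spaced lt eq in inj₁ (far-bases-separated e f p q)
    ... | tri≈ _ b≡ _ = same-base-separated e f e≢f b≡
    ... | tri> _ _ gt = let p , q = spaced gt (sym eq) in inj₂ (far-bases-separated f e p q)

    vertexColour-initial : ∀ {i c} → toℕ i ≡ toℕ {5} c → vertexColour i ≡ c
    vertexColour-initial {i} {c} eq = toℕ-injective (trans (toℕ-fromℕ< _) (trans initial eq))
      where
      initial : blockColour bs (toℕ i) ≡ toℕ i
      initial with toℕ i <? 5
      ... | yes _ = refl
      ... | no i≮5 = contradiction (subst (_< 5) (sym eq) (toℕ<n c)) i≮5

    surj : ∀ c → ∃ λ e → colour e ≡ c
    -- The edge from `c` to `c + 3` is an outer chord based at `c`, a vertex of the first block, so
    -- its colour is `c`.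
    surj c = edge u v u<v u~v ,
      trans (cong vertexColour (place-jump3 u~v u⊕3≡v)) (vertexColour-initial toℕu)
      where
      c+3<n : toℕ c + 3 < n
      c+3<n = <-≤-trans (+-monoˡ-< 3 (toℕ<n c)) 8≤n
      u = fromℕ< (≤-<-trans (m≤m+n (toℕ c) 3) c+3<n)
      v = fromℕ< c+3<n
      toℕu : toℕ u ≡ toℕ c
      toℕu = toℕ-fromℕ< _
      toℕv : toℕ v ≡ toℕ u + 3
      toℕv = trans (toℕ-fromℕ< _) (cong (_+ 3) (sym toℕu))
      u<v : u Fin.< v
      u<v = subst (toℕ u <_) (sym toℕv) (m<m+n (toℕ u) (s≤s z≤n))
      u⊕3≡v : u ⊕ 3 ≡ v
      u⊕3≡v = Offset⇒⊕ (<⇒≤ 3<n) (direct toℕv)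
      u~v : u ~ v
      u~v = there (here (inj₁ u⊕3≡v))

-- Exhaustive verification for seven and eleven vertices.

cyclic? : ∀ {n} (p q r : Fin n) → Dec (Cyclic p q r)
cyclic? p q r = (p <?ᶠ q ×-dec q <?ᶠ r) ⊎-dec (q <?ᶠ r ×-dec r <?ᶠ p) ⊎-dec (r <?ᶠ p ×-dec p <?ᶠ q)

chordsCross? : ∀ {n} (p q r s : Fin n) → Dec (ChordsCross p q r s)
chordsCross? p q r s = (cyclic? p r q ×-dec cyclic? q s p) ⊎-dec (cyclic? p s q ×-dec cyclic? q r p)

-- Colouring pairs of vertices rather than edges makes both conditions quantify over finite index
-- types, hence decidable by search.
module Finite {n k : ℕ} (G : Graph n) (ω : Permutation′ n) (c : Fin n → Fin n → Fin k) where
  open Graph G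

  Compatible : (s t s′ t′ : Fin n) → Set
  Compatible s t s′ t′ = (s ≡ s′ × t ≡ t′) ⊎
    (¬ ChordsCross (ω ⟨$⟩ʳ s) (ω ⟨$⟩ʳ t) (ω ⟨$⟩ʳ s′) (ω ⟨$⟩ʳ t′) × s ≢ s′ × s ≢ t′ × t ≢ s′ × t ≢ t′)

  Proper : Set
  Proper = ∀ s t → s Fin.< t × s ~ t → ∀ s′ t′ → s′ Fin.< t′ × s′ ~ t′ →
    c s t ≡ c s′ t′ → Compatible s t s′ t′

  Onto : Set
  Onto = ∀ a → ∃ λ s → ∃ λ t → (s Fin.< t × s ~ t) × c s t ≡ a

  edge? : ∀ s t → Dec (s Fin.< t × s ~ t)
  edge? s t = s <?ᶠ t ×-dec s ~? t

  proper? : Dec Proper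
  proper? = all? λ s → all? λ t → edge? s t →-dec all? λ s′ → all? λ t′ → edge? s′ t′ →-dec
    (c s t ≟ c s′ t′ →-dec
      ((s ≟ s′ ×-dec t ≟ t′) ⊎-dec
       (¬? (chordsCross? (ω ⟨$⟩ʳ s) (ω ⟨$⟩ʳ t) (ω ⟨$⟩ʳ s′) (ω ⟨$⟩ʳ t′))
         ×-dec ¬? (s ≟ s′) ×-dec ¬? (s ≟ t′) ×-dec ¬? (t ≟ s′) ×-dec ¬? (t ≟ t′))))

  onto? : Dec Onto
  onto? = all? λ a → any? λ s → any? λ t → edge? s t ×-dec c s t ≟ a

  embedding : Proper → Onto → MatchingBookEmbedding G k
  embedding proper onto = record
    { ω           = ω
    ; colour      = col
    ; colour-surj = surj
    ; noncrossing = λ e f e≢f eq → proj₁ (apart e f e≢f eq)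
    ; matching    = λ e f e≢f eq → disjoint {e} {f} (proj₂ (apart e f e≢f eq))
    }
    where
    open Edge
    col : Edge G → Fin k
    col e = c (src e) (tgt e)
    surj : ∀ a → ∃ λ e → col e ≡ a
    surj a with onto a
    ... | s , t , (s<t , s~t) , eq = edge s t s<t s~t , eq
    valid : ∀ e → src e Fin.< tgt e × src e ~ tgt e
    valid (edge s t s<t s~t) = recompute (s <?ᶠ t) s<t , recompute (s ~? t) s~t
    apart : ∀ e f → e ≢ f → col e ≡ col f → ¬ Cross ω e f ×
      src e ≢ src f × src e ≢ tgt f × tgt e ≢ src f × tgt e ≢ tgt f
    apart e f e≢f eq with proper _ _ (valid e) _ _ (valid f) eq
    ... | inj₁ (refl , refl) = contradiction refl e≢f
    ... | inj₂ ok            = ok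
    disjoint : ∀ {e f : Edge G} → src e ≢ src f × src e ≢ tgt f × tgt e ≢ src f × tgt e ≢ tgt f →
      ¬ ShareEndpoint e f
    disjoint (ss , st , ts , tt) (_ , inj₁ refl , inj₁ eq) = ss eq
    disjoint (ss , st , ts , tt) (_ , inj₁ refl , inj₂ eq) = st eq
    disjoint (ss , st , ts , tt) (_ , inj₂ refl , inj₁ eq) = ts eq
    disjoint (ss , st , ts , tt) (_ , inj₂ refl , inj₂ eq) = tt eq

-- The i-th entries of the two vectors colour the edges {i, i+1} and {i, i+3}.
tableColouring : ∀ {n k} → Vec (Fin k) n → Vec (Fin k) n → Fin n → Fin n → Fin k
tableColouring c₁ c₃ s t =
  if does (s ⊕ 1 ≟ t) then lookup c₁ s else
  if does (t ⊕ 1 ≟ s) then lookup c₁ t else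
  if does (s ⊕ 3 ≟ t) then lookup c₃ s else lookup c₃ t

-- In both cases only the last two vertices are swapped in the natural order.
embedding₇ : (7≤7 : 7 ≤ 7) → MatchingBookEmbedding (circulant 7 (⟨1,3⟩ 7≤7)) 5
embedding₇ 7≤7 = F.embedding (toWitness {a? = F.proper?} _) (toWitness {a? = F.onto?} _)
  where
  module F = Finite (circulant 7 (⟨1,3⟩ 7≤7)) (transpose (Fin.opposite 0F) (Fin.opposite 1F))
    (tableColouring
      (3F ∷ 0F ∷ 1F ∷ 4F ∷ 0F ∷ 1F ∷ 2F ∷ [])
      (0F ∷ 2F ∷ 3F ∷ 3F ∷ 1F ∷ 4F ∷ 4F ∷ []))

embedding₁₁ : (7≤11 : 7 ≤ 11) → MatchingBookEmbedding (circulant 11 (⟨1,3⟩ 7≤11)) 5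
embedding₁₁ 7≤11 = F.embedding (toWitness {a? = F.proper?} _) (toWitness {a? = F.onto?} _)
  where
  module F = Finite (circulant 11 (⟨1,3⟩ 7≤11)) (transpose (Fin.opposite 0F) (Fin.opposite 1F))
    (tableColouring
      (4F ∷ 1F ∷ 3F ∷ 2F ∷ 0F ∷ 4F ∷ 2F ∷ 0F ∷ 4F ∷ 2F ∷ 3F ∷ [])
      (1F ∷ 3F ∷ 2F ∷ 0F ∷ 4F ∷ 3F ∷ 1F ∷ 1F ∷ 2F ∷ 0F ∷ 0F ∷ []))

-- Block decompositions of odd numbers, and the conclusion.

-- The list omits the obligatory first block of 5. The remainders 2 and 6 are not sums of 4s and 5s,
-- so 7 and 11 stand alone.
data BlockDecomposition : ℕ → Set where
  seven  : BlockDecomposition 7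
  eleven : BlockDecomposition 11
  blocks : ∀ {n} bs → All (4 ≤_) bs → All (_≤ 5) bs → 8 ≤ n → 5 + sum bs ≡ n → BlockDecomposition n

extend : ∀ {n} → BlockDecomposition n → BlockDecomposition (4 + n)
extend seven  = eleven
-- Eleven has no blocks to extend; 15 is cut afresh as 5 + 5 + 5, the first 5 being implicit.
extend eleven = blocks (5 ∷ 5 ∷ []) (n≤1+n 4 ∷ n≤1+n 4 ∷ []) (≤-refl ∷ ≤-refl ∷ []) (m≤m+n 8 7) refl
extend (blocks bs 4≤bs bs≤5 8≤n eq) =
  blocks (4 ∷ bs) (≤-refl ∷ 4≤bs) (n≤1+n 4 ∷ bs≤5) (m≤n⇒m≤o+n 4 8≤n) (cong (4 +_) eq)

odd⇒BlockDecomposition : ∀ {n} → 7 ≤ n → n % 2 ≡ 1 → BlockDecomposition n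
odd⇒BlockDecomposition (s≤s (s≤s (s≤s (s≤s (s≤s (s≤s (s≤s (z≤n {m})))))))) = go m
  where
  go : ∀ m → (7 + m) % 2 ≡ 1 → BlockDecomposition (7 + m)
  go 0 _ = seven
  go 1 ()
  go 2 _ = blocks (4 ∷ []) (≤-refl ∷ []) (n≤1+n 4 ∷ []) (n≤1+n 8) refl
  go 3 ()
  -- The remainder modulo 2 computes through the four successors, so the parity proof is passed on
  -- unchanged.
  go (suc (suc (suc (suc m)))) odd = extend (go m odd)

five-page-embedding : ∀ {n} (7≤n : 7 ≤ n) → BlockDecomposition n →
  MatchingBookEmbedding (circulant n (⟨1,3⟩ 7≤n)) 5
five-page-embedding 7≤n seven  = embedding₇ 7≤n
five-page-embedding 7≤n eleven = embedding₁₁ 7≤n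
five-page-embedding 7≤n (blocks bs 4≤bs bs≤5 8≤n eq) = blockEmbedding 7≤n bs 4≤bs bs≤5 8≤n eq

Δ≡⇒NearlyDispersable : ∀ {n k} {G : Graph n} → Δ G ≡ k →
  ¬ MatchingBookEmbedding G k → MatchingBookEmbedding G (1 + k) → NearlyDispersable G
Δ≡⇒NearlyDispersable refl ¬M M = ¬M , M

theorem2 : (n : ℕ) (n≥7 : n ≥ 7) → n % 2 ≡ 1 → NearlyDispersable (circulant n (⟨1,3⟩ n≥7))
theorem2 n n≥7 odd =
  Δ≡⇒NearlyDispersable (Δ≡k (fromℕ< n≥7))
    (λ M → 0≢1+n (trans (sym (k-colourable⇒even 0F M)) odd))
    (five-page-embedding n≥7 (odd⇒BlockDecomposition n≥7 odd))
  where open CirculantRegular n≥7
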